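{- Let $G$ be an infinite, connected, countable graph such that every vertex has degree at most a constant $D$. For any starting vertex and any initial port, the random basic walk on $G$ cycles with probability $1$.
   Context: Each undirected edge $\{v,w\}$ is regarded as two arcs $v\to w$ and $w\to v$. A labeling assigns, at each vertex $v$ of degree $\deg(v)$, the port numbers $1,\dots,\deg(v)$ bijectively to the arcs leaving $v$ (labels on $v\to w$ and $w\to v$ need not agree). In a random labeling these bijections are chosen uniformly at random, independently for different vertices. Given a labeling, a starting vertex $v_0$ and an initial port $\ell$, the basic walk leaves $v_0$ along the arc labeled $\ell$; thereafter, whenever it enters a vertex $v$ along an arc whose label is $i$, it leaves $v$ along the arc out of $v$ labeled $(i \bmod \deg(v))+1$. The random basic walk is the basic walk for a random labeling. The walk cycles if some arc is traversed twice in the same direction (equivalently, from some point on it is periodic and visits only finitely many vertices); it is transient otherwise. -}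

module Defs where

open import Data.Fin using (Fin; toℕ)
open import Data.Fin.Permutation using (Permutation′; _⟨$⟩ʳ_; _⟨$⟩ˡ_) renaming (_≈_ to _≈ₚ_)
open import Data.Fin.Properties using (nonZeroIndex)
open import Data.Integer using (+_)
open import Data.List using (List; map; foldr)
open import Data.List.Membership.Propositional using (_∈_)
open import Data.List.Relation.Unary.All using (All)
open import Data.List.Relation.Unary.Unique.Propositional using (Unique)
open import Data.Maybe using (Maybe; just; nothing)
open import Data.Nat using (ℕ; zero; suc; _≤_; _<_; NonZero; _!)
open import Data.Nat.DivMod using (_mod_)
open import Data.Nat.Properties using (_!≢0)
open import Data.Product using (Σ; ∃-syntax; _×_; _,_; proj₁)
open import Data.Rational using (ℚ; 0ℚ; 1ℚ) renaming (_+_ to _+ℚ_; _*_ to _*ℚ_; _≤_ to _≤ℚ_; _<_ to _<ℚ_; _/_ to _/ℚ_)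
open import Function.Bundles using (_↣_)
open import Function.Definitions using (Injective)
open import Relation.Binary.Construct.Closure.ReflexiveTransitive using (Star)
open import Relation.Binary.PropositionalEquality using (_≡_)
open import Relation.Nullary using (¬_)
open import Relation.Unary using (Pred; ∁)
open import Level using (0ℓ)

record Graph : Set₁ where
  infix 4 _~_
  field
    Vertex   : Set
    _~_      : Vertex → Vertex → Set
    ~-sym    : ∀ {v w} → v ~ w → w ~ v
    ~-irrefl : ∀ {v} → ¬ (v ~ v)

module _ (G : Graph) where
  open Graph G

  Infinite : Set
  Infinite = ¬ (∃[ vs ] ∀ (v : Vertex) → v ∈ vs)

  Countable : Set
  Countable = Vertex ↣ ℕ

  Connected : Set
  Connected = ∀ v w → Star _~_ v w

  -- For each v, a repetition-free enumeration of the neighbours of v.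
  record LocallyFinite : Set where
    field
      deg           : Vertex → ℕ
      nbr           : ∀ v → Fin (deg v) → Vertex
      nbr-injective : ∀ v → Injective _≡_ _≡_ (nbr v)
      nbr-sound     : ∀ v k → v ~ nbr v k
      nbr-complete  : ∀ {v w} → v ~ w → ∃[ k ] nbr v k ≡ w

module RandomBasicWalk {G : Graph} (F : LocallyFinite G) where
  open Graph G
  open LocallyFinite F

  DegreeAtMost : ℕ → Set
  DegreeAtMost D = ∀ v → deg v ≤ D

  -- (v , k) is the arc v → nbr v k.
  Arc : Set
  Arc = Σ Vertex λ v → Fin (deg v)

  head : Arc → Vertex
  head (v , k) = nbr v k

  -- p : Port v stands for the port number suc (toℕ p) ∈ {1, …, deg v}.
  Port : Vertex → Set
  Port v = Fin (deg v)

  -- ω v ⟨$⟩ʳ k is the port of the arc (v , k), and ω v ⟨$⟩ˡ p the index of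
  -- the arc out of v with port p.
  Labeling : Set
  Labeling = ∀ v → Permutation′ (deg v)

  portNumber : Labeling → Arc → ℕ
  portNumber ω (v , k) = suc (toℕ (ω v ⟨$⟩ʳ k))

  arcAt : Labeling → (v : Vertex) → Port v → Arc
  arcAt ω v p = v , ω v ⟨$⟩ˡ p

  deg-head-nonZero : ∀ a → NonZero (deg (head a))
  deg-head-nonZero (v , k) = nonZeroIndex (proj₁ (nbr-complete (~-sym (nbr-sound v k))))

  -- Since ports are counted from 0 in Fin, the port with number
  -- (i mod d) + 1 is the element i mod d of Fin d.
  step : Labeling → Arc → Arc
  step ω a = arcAt ω (head a) (portNumber ω a mod deg (head a))
    where instance _ = deg-head-nonZero a

  walk : Labeling → (v₀ : Vertex) → Port v₀ → ℕ → Arc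
  walk ω v₀ ℓ zero    = arcAt ω v₀ ℓ
  walk ω v₀ ℓ (suc t) = step ω (walk ω v₀ ℓ t)

  Cycles : (v₀ : Vertex) → Port v₀ → Pred Labeling 0ℓ
  Cycles v₀ ℓ ω = ∃[ s ] ∃[ t ] s < t × walk ω v₀ ℓ s ≡ walk ω v₀ ℓ t

  -- The event that the labels at finitely many distinct vertices are the
  -- prescribed ones.
  record Cylinder : Set where
    field
      prescribed : List (Σ Vertex λ v → Permutation′ (deg v))
      distinct   : Unique (map proj₁ prescribed)

  open Cylinder

  -- Permutations are compared as functions, by _≈ₚ_.
  _∈ᶜ_ : Labeling → Cylinder → Set
  ω ∈ᶜ C = All (λ (v , σ) → ω v ≈ₚ σ) (prescribed C)

  -- Each of the (deg v)! bijections at v is equally likely, and distinct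
  -- vertices are independent.
  prob : Cylinder → ℚ
  prob C = foldr (λ (v , _) q → uniform (deg v) *ℚ q) 1ℚ (prescribed C)
    where
    uniform : ℕ → ℚ
    uniform d = _/ℚ_ (+ 1) (d !) {{d !≢0}}

  -- nothing is the empty event, so that a cover may be finite.
  Cover : Set
  Cover = ℕ → Maybe Cylinder

  prob? : Maybe Cylinder → ℚ
  prob? nothing  = 0ℚ
  prob? (just C) = prob C

  partialSum : Cover → ℕ → ℚ
  partialSum c zero    = 0ℚ
  partialSum c (suc n) = partialSum c n +ℚ prob? (c n)

  _Covers_ : Cover → Pred Labeling 0ℓ → Set
  c Covers E = ∀ ω → E ω → ∃[ n ] ∃[ C ] c n ≡ just C × ω ∈ᶜ C

  -- Outer measure zero for the product of the uniform measures: the infimum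
  -- of the total probability over countable covers by cylinders is 0.
  Null : Pred Labeling 0ℓ → Set
  Null E = ∀ ε → 0ℚ <ℚ ε → ∃[ c ] c Covers E × (∀ n → partialSum c n ≤ℚ ε)

  WithProbabilityOne : Pred Labeling 0ℓ → Set
  WithProbabilityOne E = Null (∁ E)

{-# OPTIONS --safe #-}

-- Reveal the labels one arc at a time, as the walk needs them: an arc leaving
-- through a port that has been revealed before closes a cycle, and otherwise the
-- next arc is uniform among the unrevealed arcs at the current vertex.
--
-- Suppose the walk enters a vertex u for the first time, from p through port i,
-- and deg p ≤ deg u. No arc into u other than p → u has been revealed, so with
-- probability bounded below the walk goes back and forth between u and new
-- neighbours of u. The ports it uses at u are distinct until it cycles, so it
-- would come to use the port e with (e mod deg p) + 1 = i, which exists because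
-- deg p ≤ deg u. If the arc at e is u → p, the walk then leaves p through
-- port i, which closes a cycle. All this takes at most 2 D steps.
--
-- Such arrivals keep occurring: weigh each unrevealed arc at a visited vertex v
-- by (deg v)!. Every other step lowers the total weight, since d · d! < (deg p)!
-- when a new vertex has degree d < deg p. Hence the probability that the walk
-- has not cycled decays geometrically in the number of such arrivals.
module Submission where

open import Defs
open import Data.Fin as Fin using (Fin; zero; suc; toℕ; fromℕ<)
open import Data.Fin.Permutation using (_⟨$⟩ʳ_; _⟨$⟩ˡ_; _∘ₚ_; transpose; inverseˡ; inverseʳ)
  renaming (id to idₚ; _≈_ to _≈ₚ_)
open import Data.Fin.Properties using (toℕ<n; toℕ-fromℕ<; toℕ-injective)
import Data.Integer as ℤ
import Data.Integer.Properties as ℤ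
import Data.Integer.Tactic.RingSolver as ℤ-Solver
open import Data.List using (List; []; _∷_; _++_; map; length; filter; allFin; concatMap; deduplicate)
open import Data.List.Membership.Propositional using (_∈_; _∉_; find)
open import Data.List.Membership.Propositional.Properties
  using (∈-filter⁺; ∈-filter⁻; ∈-allFin; ∈-length; ∈-deduplicate⁺; ∈-concatMap⁺)
open import Data.List.Properties
  using (length-filter; length-tabulate; length-++; filter-all; filter-accept; filter-reject; map-cong; map-cong-local; map-id; map-∘)
open import Data.List.Relation.Binary.Permutation.Propositional using (_↭_; ↭-refl; ↭-trans; prep; swap)
open import Data.List.Relation.Binary.Permutation.Propositional.Properties using (filter-↭; ↭-length; map⁺)
open import Data.List.Relation.Unary.All as All using (All; []; _∷_)
import Data.List.Relation.Unary.All.Properties as All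
open import Data.List.Relation.Unary.Any as Any using (Any; here; there)
import Data.List.Relation.Unary.Any.Properties as Any
open import Data.List.Relation.Unary.Unique.DecPropositional.Properties using (deduplicate-!)
open import Data.List.Relation.Unary.Unique.Propositional using (Unique; []; _∷_)
open import Data.List.Relation.Unary.Unique.Propositional.Properties using (allFin⁺)
open import Data.Maybe using (just; nothing)
open import Data.Nat
open import Data.Nat.DivMod using (_mod_; _%_; m<n⇒m%n≡m; n%n≡0)
open import Data.Nat.ListAction using (sum; product)
open import Data.Nat.ListAction.Properties using (sum-↭; product-↭)
open import Data.Nat.Properties
open import Data.Nat.Tactic.RingSolver using (solve-∀)
open import Data.Product using (Σ; ∃-syntax; _×_; _,_; proj₁; proj₂)
open import Data.Product.Properties using (≡-dec)
open import Data.Rational using (mkℚ; 0ℚ; toℚᵘ; *<*; ↧ₙ_)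
  renaming (_+_ to _+ℚ_; _*_ to _*ℚ_; _≤_ to _≤ℚ_; _<_ to _<ℚ_; _/_ to _/ℚ_)
import Data.Rational.Properties as ℚ
open import Data.Rational.Unnormalised as ℚᵘ using (mkℚᵘ; *≤*; *≡*)
import Data.Rational.Unnormalised.Properties as ℚᵘ
open import Data.Sum using (_⊎_; inj₁; inj₂)
open import Function using (_∘_; id)
open import Level using (0ℓ)
open import Relation.Binary.Definitions using (DecidableEquality)
open import Relation.Binary.PropositionalEquality using (_≡_; _≢_; refl; sym; trans; cong; cong₂; subst)
open import Relation.Nullary using (¬_; yes; no; contradiction; ¬?)
open import Relation.Nullary.Decidable using (dec-true; dec-false; via-injection)
open import Relation.Unary using (Pred; Decidable)

-- Lists: filtering, and sums and products when one entry changes.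

module _ {A : Set} where

  extract : ∀ {x : A} {xs} → x ∈ xs → Unique xs → ∃[ ys ] xs ↭ x ∷ ys × All (x ≢_) ys
  extract {xs = _ ∷ xs} (here refl) (x≢ ∷ _)  = xs , ↭-refl , x≢
  extract {x} {y ∷ _}   (there x∈)  (y≢ ∷ u)  with extract x∈ u
  ... | ys , xs↭ , x≢ys =
    y ∷ ys , ↭-trans (prep y xs↭) (swap y x ↭-refl) , (λ x≡y → All.lookup y≢ x∈ (sym x≡y)) ∷ x≢ys

  filter-cong-local : ∀ {P Q : Pred A 0ℓ} (P? : Decidable P) (Q? : Decidable Q) {xs} →
    All (λ x → (P x → Q x) × (Q x → P x)) xs → filter P? xs ≡ filter Q? xs
  filter-cong-local P? Q? [] = refl
  filter-cong-local P? Q? {x ∷ _} ((f , g) ∷ fs) with P? x | Q? x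
  ... | yes _ | yes _ = cong (x ∷_) (filter-cong-local P? Q? fs)
  ... | yes p | no ¬q = contradiction (f p) ¬q
  ... | no ¬p | yes q = contradiction (g q) ¬p
  ... | no _  | no _  = filter-cong-local P? Q? fs

  ≤-sum : ∀ (f : A → ℕ) {x xs} → x ∈ xs → f x ≤ sum (map f xs)
  ≤-sum f (here refl) = m≤m+n _ _
  ≤-sum f {xs = y ∷ _} (there x∈) = ≤-trans (≤-sum f x∈) (m≤n+m _ (f y))

  module _ {f g : A → ℕ} {x : A} (f≗g : ∀ {y} → y ≢ x → f y ≡ g y)
    {xs : List A} (x∈xs : x ∈ xs) (xs! : Unique xs) where

    private
      ys  = proj₁ (extract x∈xs xs!)
      xs↭ : xs ↭ x ∷ ys
      xs↭ = proj₁ (proj₂ (extract x∈xs xs!))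

      map-f≡map-g : map f ys ≡ map g ys
      map-f≡map-g = map-cong-local (All.map (λ x≢y → f≗g (x≢y ∘ sym)) (proj₂ (proj₂ (extract x∈xs xs!))))

    sum-update : ∃[ r ] sum (map f xs) ≡ f x + r × sum (map g xs) ≡ g x + r
    sum-update = sum (map f ys) , sum-↭ (map⁺ f xs↭) ,
      trans (sum-↭ (map⁺ g xs↭)) (cong (λ zs → g x + sum zs) (sym map-f≡map-g))

    product-update : ∃[ r ] product (map f xs) ≡ f x * r × product (map g xs) ≡ g x * r
    product-update = product (map f ys) , product-↭ (map⁺ f xs↭) ,
      trans (product-↭ (map⁺ g xs↭)) (cong (λ zs → g x * product zs) (sym map-f≡map-g))

-- Arithmetic of ports, factorials and powers.

-- The port 0 is reached from `m - 1` by wrapping around, and `suc j` from `j`; both lie below `n`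
-- because `m ≤ n`.
suc-mod-surjective : ∀ {m n} → m ≤ n → (i : Fin m) →
  ∃[ e ] (.{{_ : NonZero m}} → suc (toℕ {n} e) mod m ≡ i)
suc-mod-surjective {suc m} m≤n zero =
  fromℕ< m≤n , toℕ-injective (trans (toℕ-fromℕ< _)
    (trans (cong (λ k → suc k % suc m) (toℕ-fromℕ< m≤n)) (n%n≡0 (suc m))))
suc-mod-surjective {suc m} m≤n (suc j) = fromℕ< j<n ,
  toℕ-injective (trans (toℕ-fromℕ< _)
    (trans (cong (λ k → suc k % suc m) (toℕ-fromℕ< j<n)) (m<n⇒m%n≡m (s≤s (toℕ<n j)))))
  where j<n = <-≤-trans (m<n⇒m<1+n (toℕ<n j)) m≤n

!-mono-≤ : ∀ {m n} → m ≤ n → m ! ≤ n !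
!-mono-≤ m≤n = go (≤⇒≤′ m≤n)
  where
  go : ∀ {m n} → m ≤′ n → m ! ≤ n !
  go ≤′-refl       = ≤-refl
  go (≤′-step m≤n) = ≤-trans (go m≤n) (m≤m+n _ _)

n*n!<m! : ∀ {n m} → n < m → n * n ! < m !
n*n!<m! {n} n<m = <-≤-trans (m<n+m (n * n !) (1≤n! n)) (!-mono-≤ n<m)

-- Bernoulli's inequality `1 + k/c ≤ (1 + 1/c)^k`, cleared of denominators.
bernoulli : ∀ c k → c ^ k * (c + k) ≤ suc c ^ k * c
bernoulli c zero    = ≤-reflexive (cong (1 *_) (+-identityʳ c))
bernoulli c (suc k) = begin
  c * c ^ k * (c + suc k)          ≤⟨ m≤m+n _ (c ^ k * k) ⟩
  c * c ^ k * (c + suc k) + c ^ k * k ≡⟨ rearrange c (c ^ k) k ⟩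
  suc c * (c ^ k * (c + k))        ≤⟨ *-monoʳ-≤ (suc c) (bernoulli c k) ⟩
  suc c * (suc c ^ k * c)          ≡⟨ *-assoc (suc c) (suc c ^ k) c ⟨
  suc c * suc c ^ k * c            ∎
  where
  open ≤-Reasoning
  rearrange : ∀ c e k → c * e * (c + suc k) + e * k ≡ suc c * (e * (c + k))
  rearrange = solve-∀

geometric-decay : ∀ c b → ∃[ k ] c ^ k * b ≤ suc c ^ k
geometric-decay zero    b = 1 , z≤n
-- With exponent `c * b` Bernoulli's inequality gives `1 + b`, which exceeds `b`.
geometric-decay c@(suc _) b = c * b , *-cancelʳ-≤ _ _ c (begin
  c ^ (c * b) * b * c              ≤⟨ m≤m+n _ (c ^ (c * b) * c) ⟩
  c ^ (c * b) * b * c + c ^ (c * b) * c ≡⟨ rearrange (c ^ (c * b)) b c ⟩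
  c ^ (c * b) * (c + c * b)        ≤⟨ bernoulli c (c * b) ⟩
  suc c ^ (c * b) * c              ∎)
  where
  open ≤-Reasoning
  rearrange : ∀ e b c → e * b * c + e * c ≡ e * (c + c * b)
  rearrange = solve-∀

-- Partially revealed labelings.

module Exposure {G : Graph} (F : LocallyFinite G) (_≟ᵥ_ : DecidableEquality (Graph.Vertex G)) where
  open Graph G
  open LocallyFinite F
  open RandomBasicWalk F

  -- Slot and Arc are the same type, but a slot holds a port and an arc an index
  -- into nbr.
  Slot : Set
  Slot = Σ Vertex Port

  arcOf : Labeling → Slot → Arc
  arcOf ω (v , p) = arcAt ω v p

  _≟ₛ_ : DecidableEquality Slot
  _≟ₛ_ = ≡-dec _≟ᵥ_ Fin._≟_

  open import Data.List.Membership.DecPropositional _≟ₛ_ using () renaming (_∈?_ to _∈ₛ?_)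

  ,-injective : ∀ {v} {k l : Fin (deg v)} → _≡_ {A = Slot} (v , k) (v , l) → k ≡ l
  ,-injective refl = refl

  ∉-≢ : ∀ {E : List Slot} {s t} → s ∈ E → t ∉ E → s ≢ t
  ∉-≢ s∈ t∉ refl = t∉ s∈

  frees : List Slot → (v : Vertex) → List (Port v)
  frees E v = filter (λ p → ¬? ((v , p) ∈ₛ? E)) (allFin (deg v))

  free : List Slot → Vertex → ℕ
  free E v = length (frees E v)

  module _ {E : List Slot} {v : Vertex} where

    ∈-frees⁺ : ∀ {p} → (v , p) ∉ E → p ∈ frees E v
    ∈-frees⁺ {p} p∉ = ∈-filter⁺ (λ p → ¬? ((v , p) ∈ₛ? E)) (∈-allFin p) p∉

    ∈-frees⁻ : ∀ {p} → p ∈ frees E v → (v , p) ∉ E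
    ∈-frees⁻ p∈ = proj₂ (∈-filter⁻ (λ p → ¬? ((v , p) ∈ₛ? E)) {xs = allFin (deg v)} p∈)

    free≤deg : free E v ≤ deg v
    free≤deg = ≤-trans (length-filter _ (allFin (deg v))) (≤-reflexive (length-tabulate id))

    frees-∷-≢ : ∀ {s} → proj₁ s ≢ v → frees (s ∷ E) v ≡ frees E v
    frees-∷-≢ {s} s≢ = filter-cong-local
      (λ p → ¬? ((v , p) ∈ₛ? (s ∷ E))) (λ p → ¬? ((v , p) ∈ₛ? E)) {allFin (deg v)} (All.universal (λ p →
        (λ p∉ p∈ → p∉ (there p∈)) ,
        λ { p∉ (here refl) → s≢ refl ; p∉ (there p∈) → p∉ p∈ }) _)

    free-∷ : ∀ {p} → (v , p) ∉ E → free E v ≡ suc (free ((v , p) ∷ E) v)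
    free-∷ {p} p∉ = trans (↭-length (filter-↭ P? all↭)) (trans (accept p∉) (cong suc
      (trans (cong length (filter-cong-local P? Q? (All.map (λ p≢q →
        (λ { q∉ (here refl) → p≢q refl ; q∉ (there q∈) → q∉ q∈ }) ,
        (λ q∉ q∈ → q∉ (there q∈))) p≢ys)))
      (trans (reject (λ q∉ → q∉ (here refl))) (sym (↭-length (filter-↭ Q? all↭)))))))
      where
      P? = λ q → ¬? ((v , q) ∈ₛ? E)
      Q? = λ q → ¬? ((v , q) ∈ₛ? ((v , p) ∷ E))
      ys = proj₁ (extract (∈-allFin p) (allFin⁺ (deg v)))
      all↭ = proj₁ (proj₂ (extract (∈-allFin p) (allFin⁺ (deg v))))
      p≢ys = proj₂ (proj₂ (extract (∈-allFin p) (allFin⁺ (deg v))))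
      accept : (v , p) ∉ E → length (filter P? (p ∷ ys)) ≡ suc (length (filter P? ys))
      accept p∉ = cong length (filter-accept P? p∉)
      reject : ¬ (v , p) ∉ ((v , p) ∷ E) → length (filter Q? ys) ≡ length (filter Q? (p ∷ ys))
      reject p∈ = cong length (sym (filter-reject Q? p∈))

  free-[] : ∀ v → free [] v ≡ deg v
  free-[] v = trans (cong length (filter-all (λ p → ¬? ((v , p) ∈ₛ? [])) {allFin (deg v)} (All.universal (λ _ ()) _)))
    (length-tabulate id)

  -- Partial knowledge is kept as a full labeling that counts only at the revealed slots. Its open
  -- ports at `v` hold exactly the unrevealed arcs there, so choosing the next arc means choosing an
  -- open port `q` and moving its arc to `p`.
  swapAt : Labeling → (v : Vertex) → Port v → Port v → Labeling
  swapAt σ v p q w with w ≟ᵥ v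
  ... | yes refl = σ w ∘ₚ transpose p q
  ... | no _     = σ w

  module _ (σ : Labeling) {v : Vertex} {p q : Port v} where

    arcOf-swapAt-≡ : arcOf (swapAt σ v p q) (v , p) ≡ (v , σ v ⟨$⟩ˡ q)
    arcOf-swapAt-≡ with v ≟ᵥ v
    ... | no v≢v = contradiction refl v≢v
    ... | yes refl with p Fin.≟ q
    ...   | yes refl = refl
    ...   | no _ rewrite dec-true (p Fin.≟ p) refl = refl

    arcOf-swapAt-≢ : ∀ {s} → s ≢ (v , p) → s ≢ (v , q) → arcOf (swapAt σ v p q) s ≡ arcOf σ s
    arcOf-swapAt-≢ {w , r} s≢p s≢q with w ≟ᵥ v
    ... | no _     = refl
    ... | yes refl rewrite dec-false (r Fin.≟ q) (λ { refl → s≢q refl })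
                         | dec-false (r Fin.≟ p) (λ { refl → s≢p refl }) = refl

    arcOf-swapAt-∈ : ∀ {E s} → (v , p) ∉ E → (v , q) ∉ E → s ∈ E →
      arcOf (swapAt σ v p q) s ≡ arcOf σ s
    arcOf-swapAt-∈ p∉ q∉ s∈ = arcOf-swapAt-≢ (∉-≢ s∈ p∉) (∉-≢ s∈ q∉)

  Agrees : Labeling → Labeling → List Slot → Set
  Agrees ω σ E = ∀ {s} → s ∈ E → arcOf ω s ≡ arcOf σ s

  module _ {ω σ : Labeling} {E : List Slot} {v : Vertex} {p : Port v} (p∉ : (v , p) ∉ E) where

    -- Take for `q` the port at which `σ` has the arc that `ω` has at `p`. Were `q` revealed, `ω`
    -- would have this arc at `q` too, forcing `q ≡ p`.
    agrees-swapAt⁺ : Agrees ω σ E → ∃[ q ] (v , q) ∉ E × Agrees ω (swapAt σ v p q) ((v , p) ∷ E)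
    agrees-swapAt⁺ agrees = q , q∉ , λ where
        (here refl) → sym (trans (arcOf-swapAt-≡ σ) (cong (v ,_) (inverseˡ (σ v))))
        (there s∈)  → trans (agrees s∈) (sym (arcOf-swapAt-∈ σ p∉ q∉ s∈))
      where
      q : Port v
      q = σ v ⟨$⟩ʳ (ω v ⟨$⟩ˡ p)
      q∉ : (v , q) ∉ E
      q∉ q∈ = p∉ (subst (λ r → (v , r) ∈ E) q≡p q∈)
        where
        q≡p : q ≡ p
        q≡p = trans (sym (inverseʳ (ω v)))
          (trans (cong (ω v ⟨$⟩ʳ_) (trans (,-injective (agrees q∈)) (inverseˡ (σ v)))) (inverseʳ (ω v)))

    agrees-swapAt⁻ : ∀ {q} → (v , q) ∉ E → Agrees ω (swapAt σ v p q) ((v , p) ∷ E) → Agrees ω σ E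
    agrees-swapAt⁻ q∉ agrees s∈ = trans (agrees (there s∈)) (arcOf-swapAt-∈ σ p∉ q∉ s∈)

  enter : Arc → ℕ → Slot
  enter a n = head a , (n mod deg (head a)) {{deg-head-nonZero a}}

  enter-≡ : ∀ a {v} n {i : Port v} → head a ≡ v → (.{{_ : NonZero (deg v)}} → n mod deg v ≡ i) →
    enter a n ≡ (v , i)
  enter-≡ a n refl n≡i = cong (head a ,_) (n≡i {{deg-head-nonZero a}})

  -- The labels known so far are those of lab at the exposed slots; the walk
  -- is about to leave through the slot cur.
  record State : Set where
    constructor state
    field
      lab     : Labeling
      exposed : List Slot
      cur     : Slot

  open State

  expose : (h : State) → Port (proj₁ (cur h)) → State
  expose (state σ E (v , p)) q =
    state (swapAt σ v p q) ((v , p) ∷ E) (enter (v , σ v ⟨$⟩ˡ q) (suc (toℕ p)))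

  -- Whenever the label of the next arc is still open, some choice of that arc
  -- closes a cycle within j steps.
  data Closable : State → ℕ → Set where
    closed : ∀ {h j} → cur h ∈ exposed h → Closable h j
    choose : ∀ {h j} → cur h ∉ exposed h → (q : Port (proj₁ (cur h))) → (proj₁ (cur h) , q) ∉ exposed h →
      Closable (expose h q) j → Closable h (suc j)

  -- The walk has entered u for the first time through the slot (p , i). It is
  -- sent to a new neighbour of u and straight back, again and again, except
  -- that from the port e it is sent to p, where it must leave through (p , i).
  module Star {u p : Vertex} (k : Fin (deg u)) (nbr-k : nbr u k ≡ p) (i : Port p) (e : Port u)
    (e→i : .{{_ : NonZero (deg p)}} → suc (toℕ e) mod deg p ≡ i) where

    -- The point of `balance`: revealed arcs into `u`, apart from those leaving `p`, are the return
    -- halves of excursions. So the way back from a neighbour reached by an unrevealed arc is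
    -- unrevealed as well.
    record Invariant (σ : Labeling) (E : List Slot) : Set where
      field
        origin  : (p , i) ∈ E
        e-open  : (u , e) ∉ E
        p-open  : ∀ {r} → (u , r) ∈ E → head (arcOf σ (u , r)) ≢ p
        balance : ∀ {q r} → (q , r) ∈ E → head (arcOf σ (q , r)) ≡ u → q ≢ p →
          ∃[ t ] (u , t) ∈ E × head (arcOf σ (u , t)) ≡ q

    open Invariant

    ~⇒≢ : ∀ {v w} → v ~ w → v ≢ w
    ~⇒≢ v~v refl = ~-irrefl v~v

    -- Induction on the number of open ports at `u`: an excursion uses up one of them and takes two
    -- steps.
    closable : ∀ n {σ E w} (c : Port w) → w ≡ u → Invariant σ E → free E u ≤ n →
      Closable (state σ E (w , c)) (n * 2)
    closable n {σ} {E} c refl inv free≤n with (u , c) ∈ₛ? E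
    ... | yes c∈ = closed c∈
    closable zero c refl inv free≤n | no c∉ =
      contradiction (≤-trans (∈-length (∈-frees⁺ c∉)) free≤n) λ ()
    closable (suc n) {σ} {E} c refl inv free≤n | no c∉ with c Fin.≟ e
    -- The arc from `u` to `p` is still unrevealed; taking it through `e` leads to the slot
    -- `(p , i)`, which is revealed.
    ... | yes refl = choose c∉ b b∉ (closed (subst (_∈ _) (sym back) (there (origin inv))))
      where
      b = σ u ⟨$⟩ʳ k
      b∉ : (u , b) ∉ E
      b∉ b∈ = p-open inv b∈ (trans (cong (nbr u) (inverseˡ (σ u))) nbr-k)
      back : enter (u , σ u ⟨$⟩ˡ b) (suc (toℕ e)) ≡ (p , i)
      back = enter-≡ _ _ (trans (cong (nbr u) (inverseˡ (σ u))) nbr-k) e→i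
    ... | no c≢e = choose c∉ b b∉ excursion
      where
      b₀ = σ u ⟨$⟩ʳ k
      other : ∃[ b ] (u , b) ∉ E × b ≢ b₀
      -- An open port whose arc avoids `p`: `c` itself, unless `c` holds the arc to `p`; then `e`,
      -- which is open and differs from `c`.
      other with c Fin.≟ b₀
      ... | yes refl = e , e-open inv , c≢e ∘ sym
      ... | no c≢b₀  = c , c∉ , c≢b₀
      b = proj₁ other
      b∉ = proj₁ (proj₂ other)
      q = nbr u (σ u ⟨$⟩ˡ b)
      u~q : u ~ q
      u~q = nbr-sound u _
      q≢p : q ≢ p
      q≢p q≡p = proj₂ (proj₂ other) (trans (sym (inverseʳ (σ u)))
        (cong (σ u ⟨$⟩ʳ_) (nbr-injective u (trans q≡p (sym nbr-k)))))
      σ₁ = swapAt σ u c b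
      E₁ = (u , c) ∷ E
      s₁ = enter (u , σ u ⟨$⟩ˡ b) (suc (toℕ c))
      keep₁ : ∀ {s} → s ∈ E → arcOf σ₁ s ≡ arcOf σ s
      keep₁ = arcOf-swapAt-∈ σ c∉ b∉
      head-c₁ : head (arcOf σ₁ (u , c)) ≡ q
      head-c₁ = cong head (arcOf-swapAt-≡ σ)
      excursion : Closable (state σ₁ E₁ s₁) (suc (n * 2))
      excursion with s₁ ∈ₛ? E₁
      ... | yes s₁∈ = closed s₁∈
      ... | no s₁∉ = choose s₁∉ r r∉ (closable n _ return inv₂ free₂≤n)
        where
        l = proj₁ (nbr-complete (~-sym u~q))
        r = σ₁ q ⟨$⟩ʳ l
        return : head (arcOf σ₁ (q , r)) ≡ u
        return = trans (cong (nbr q) (inverseˡ (σ₁ q))) (proj₂ (nbr-complete (~-sym u~q)))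
        -- If the arc from `q` to `u` had been revealed, `balance` would make the arc from `u` to
        -- `q` revealed too, but that arc sits at the open port `b`.
        r∉ : (q , r) ∉ E₁
        r∉ (here eq)  = ~⇒≢ u~q (sym (cong proj₁ eq))
        r∉ (there r∈) with balance inv r∈ (trans (cong head (sym (keep₁ r∈))) return) q≢p
        ... | t , t∈ , eq = b∉ (subst (λ x → (u , x) ∈ E)
              (trans (sym (inverseʳ (σ u))) (trans (cong (σ u ⟨$⟩ʳ_) (nbr-injective u eq)) (inverseʳ (σ u)))) t∈)
        σ₂ = swapAt σ₁ q (proj₂ s₁) r
        E₂ = s₁ ∷ E₁
        keep₂ : ∀ {s} → s ∈ E₁ → arcOf σ₂ s ≡ arcOf σ₁ s
        keep₂ = arcOf-swapAt-∈ σ₁ s₁∉ r∉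
        keep : ∀ {s} → s ∈ E → head (arcOf σ₂ s) ≡ head (arcOf σ s)
        keep s∈ = cong head (trans (keep₂ (there s∈)) (keep₁ s∈))
        head-c₂ : head (arcOf σ₂ (u , c)) ≡ q
        head-c₂ = trans (cong head (keep₂ (here refl))) head-c₁
        free₂≤n : free E₂ u ≤ n
        free₂≤n = s≤s⁻¹ (≤-trans (≤-reflexive
          (trans (cong (suc ∘ length) (frees-∷-≢ (~⇒≢ (~-sym u~q)))) (sym (free-∷ c∉)))) free≤n)
        inv₂ : Invariant σ₂ E₂
        inv₂ .origin = there (there (origin inv))
        inv₂ .e-open (here eq)          = ~⇒≢ u~q (cong proj₁ eq)
        inv₂ .e-open (there (here eq))  = c≢e (sym (,-injective eq))
        inv₂ .e-open (there (there e∈)) = e-open inv e∈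
        inv₂ .p-open (here eq)            = contradiction (cong proj₁ eq) (~⇒≢ u~q)
        inv₂ .p-open (there (here refl))  = λ head≡p → q≢p (trans (sym head-c₂) head≡p)
        inv₂ .p-open (there (there r∈))   = λ head≡p → p-open inv r∈ (trans (sym (keep r∈)) head≡p)
        inv₂ .balance (here refl) _ _ = c , there (here refl) , head-c₂
        inv₂ .balance (there (here refl)) head≡u _ = contradiction (sym head≡u) (~⇒≢ (nbr-sound u _))
        inv₂ .balance (there (there r∈)) head≡u q≢ with balance inv r∈ (trans (sym (keep r∈)) head≡u) q≢
        ... | t , t∈ , eq = t , there (there t∈) , trans (keep t∈) eq

  potential : List Slot → List Vertex → ℕ
  potential E vs = sum (map (λ v → free E v * deg v !) vs)

  potential-∷ : ∀ {E vs v p} → v ∈ vs → Unique vs → (v , p) ∉ E →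
    potential E vs ≡ deg v ! + potential ((v , p) ∷ E) vs
  potential-∷ {E} {vs} {v} {p} v∈ vs! p∉
    with sum-update {f = λ w → free E w * deg w !} {g = λ w → free ((v , p) ∷ E) w * deg w !}
           (λ {w} w≢v → cong (λ fs → length fs * deg w !) (sym (frees-∷-≢ (w≢v ∘ sym)))) v∈ vs!
  ... | r , f≡ , g≡ = trans f≡ (trans (cong (λ f → f * deg v ! + r) (free-∷ p∉))
    (trans (+-assoc (deg v !) _ r) (cong (deg v ! +_) (sym g≡))))

-- D bounds the degrees. A cycle is closed within L steps with probability at
-- least 1 / B = 1 − C / B; W bounds the rise of the potential in a step, and Z
-- is the number of steps that each attempt may cost.
module Rates (D : ℕ) where

  L W Z B C : ℕ
  L = D * 2
  W = D * D !
  Z = suc L * suc W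
  B = D ^ L
  C = pred B

  B≡1+C : .{{_ : NonZero D}} → B ≡ suc C
  B≡1+C = sym (suc-pred B {{m^n≢0 D L}})

-- Counting the labelings of a finite vertex set `S` that escape cycling.

module Counting {G : Graph} (F : LocallyFinite G) (_≟ᵥ_ : DecidableEquality (Graph.Vertex G))
  (S : List (Graph.Vertex G)) (S! : Unique S)
  (v₀ : Graph.Vertex G) (ℓ : RandomBasicWalk.Port F v₀) where
  open Graph G
  open LocallyFinite F
  open RandomBasicWalk F
  open Exposure F _≟ᵥ_
  open State
  open import Data.List.Membership.DecPropositional _≟ₛ_ using () renaming (_∈?_ to _∈ₛ?_)
  open import Data.List.Membership.DecPropositional _≟ᵥ_ using () renaming (_∈?_ to _∈ᵥ?_)

  -- The number of ways to distribute the unrevealed arcs at the vertices of `S` over the open ports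
  -- there.
  completions : List Slot → ℕ
  completions E = product (map (λ v → free E v !) S)

  completions-∷ : ∀ {E v p} → v ∈ S → (v , p) ∉ E →
    completions E ≡ free E v * completions ((v , p) ∷ E)
  completions-∷ {E} {v} {p} v∈S p∉
    with product-update {f = λ w → free E w !} {g = λ w → free ((v , p) ∷ E) w !}
           (λ w≢v → cong (λ fs → length fs !) (sym (frees-∷-≢ (w≢v ∘ sym)))) v∈S S!
  ... | r , eq , eq′ = trans eq (trans (cong (λ f → f ! * r) (free-∷ p∉))
    (trans (*-assoc (suc f′) (f′ !) r) (cong₂ _*_ (sym (free-∷ p∉)) (sym eq′))))
    where f′ = free ((v , p) ∷ E) v

  -- The conditional probability, given the labels of σ at E, that the walk
  -- does not cycle is at most (y − x) / K.
  record Escape≤ (K x y : ℕ) (σ : Labeling) (E : List Slot) : Set where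
    field
      labelings : List Labeling
      covers    : ∀ {ω} → Agrees ω σ E → ¬ Cycles v₀ ℓ ω →
        Any (λ τ → All (λ v → ω v ≈ₚ τ v) S) labelings
      bound     : length labelings * K + completions E * x ≤ completions E * y

  open Escape≤

  escape-cycling : ∀ {K x y σ E} → (∀ {ω} → Agrees ω σ E → Cycles v₀ ℓ ω) → x ≤ y → Escape≤ K x y σ E
  escape-cycling cycles x≤y .labelings = []
  escape-cycling cycles x≤y .covers agrees ¬cycles = contradiction (cycles agrees) ¬cycles
  escape-cycling {E = E} cycles x≤y .bound = *-monoʳ-≤ (completions E) x≤y

  module _ {K y : ℕ} {σ : Labeling} {E : List Slot} {v : Vertex} {p : Port v} (x : Port v → ℕ)
    (children : ∀ q → (v , q) ∉ E → Escape≤ K (x q) y (swapAt σ v p q) ((v , p) ∷ E)) where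

    private
      N′ = completions ((v , p) ∷ E)

    escape-union : ∀ qs → (∀ {q} → q ∈ qs → (v , q) ∉ E) → ∃[ τs ]
      (∀ {ω q} → q ∈ qs → Agrees ω (swapAt σ v p q) ((v , p) ∷ E) → ¬ Cycles v₀ ℓ ω →
        Any (λ τ → All (λ w → ω w ≈ₚ τ w) S) τs) ×
      length τs * K + N′ * sum (map x qs) ≤ length qs * (N′ * y)
    escape-union [] _ = [] , (λ ()) , ≤-reflexive (*-zeroʳ N′)
    escape-union (q ∷ qs) q∉ with escape-union qs (q∉ ∘ there) | children q (q∉ (here refl))
    ... | τs , cov , τs≤ | c = labelings c ++ τs , cov′ , (begin
        length (labelings c ++ τs) * K + N′ * (x q + s)           ≡⟨ cong (λ l → l * K + N′ * (x q + s)) (length-++ (labelings c)) ⟩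
        (length (labelings c) + length τs) * K + N′ * (x q + s)   ≡⟨ rearrange (length (labelings c)) (length τs) K N′ (x q) s ⟩
        (length (labelings c) * K + N′ * x q) + (length τs * K + N′ * s)  ≤⟨ +-mono-≤ (bound c) τs≤ ⟩
        N′ * y + length qs * (N′ * y)                             ∎)
      where
      open ≤-Reasoning
      s = sum (map x qs)
      rearrange : ∀ a b k n x s → (a + b) * k + n * (x + s) ≡ (a * k + n * x) + (b * k + n * s)
      rearrange = solve-∀
      cov′ : ∀ {ω r} → r ∈ q ∷ qs → Agrees ω (swapAt σ v p r) ((v , p) ∷ E) → ¬ Cycles v₀ ℓ ω →
        Any (λ τ → All (λ w → ω w ≈ₚ τ w) S) (labelings c ++ τs)
      cov′ (here refl) agrees ¬cycles = Any.++⁺ˡ (covers c agrees ¬cycles)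
      cov′ (there r∈)  agrees ¬cycles = Any.++⁺ʳ (labelings c) (cov r∈ agrees ¬cycles)

    -- The law of total probability for the label at `(v , p)`: by `agrees-swapAt⁺` every compatible
    -- labeling belongs to a child, and by `completions-∷` all children have equally many
    -- completions.
    escape-average : ∀ {x₀} → v ∈ S → (v , p) ∉ E → free E v * x₀ ≤ sum (map x (frees E v)) → Escape≤ K x₀ y σ E
    escape-average {x₀} v∈S p∉ x₀≤ with escape-union (frees E v) (λ q∈ → ∈-frees⁻ q∈)
    ... | τs , cov , τs≤ = record
      { labelings = τs
      ; covers    = λ {ω} agrees ¬cycles → let q , q∉ , agrees′ = agrees-swapAt⁺ {ω} p∉ agrees in cov (∈-frees⁺ q∉) agrees′ ¬cycles
      ; bound     = begin
          length τs * K + completions E * x₀       ≡⟨ cong (λ n → length τs * K + n * x₀) N≡ ⟩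
          length τs * K + free E v * N′ * x₀       ≡⟨ cong (length τs * K +_) (rearrange (free E v) N′ x₀) ⟩
          length τs * K + N′ * (free E v * x₀)     ≤⟨ +-monoʳ-≤ (length τs * K) (*-monoʳ-≤ N′ x₀≤) ⟩
          length τs * K + N′ * sum (map x (frees E v)) ≤⟨ τs≤ ⟩
          free E v * (N′ * y)                      ≡⟨ *-assoc (free E v) N′ y ⟨
          free E v * N′ * y                        ≡⟨ cong (_* y) N≡ ⟨
          completions E * y                        ∎
      }
      where
      open ≤-Reasoning
      N≡ = completions-∷ v∈S p∉
      rearrange : ∀ f n x → f * n * x ≡ n * (f * x)
      rearrange = solve-∀

  escape-uniform : ∀ {K y σ E v} {p : Port v} → v ∈ S → (v , p) ∉ E →
    (∀ q → (v , q) ∉ E → Escape≤ K 0 y (swapAt σ v p q) ((v , p) ∷ E)) → Escape≤ K 0 y σ E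
  escape-uniform {E = E} {v} v∈S p∉ children = escape-average (λ _ → 0) children v∈S p∉ (≤-trans (≤-reflexive (*-zeroʳ (free E v))) z≤n)

  escape-exposed : ∀ {E} → All (λ v → frees E v ≡ []) S → ∀ σ → Escape≤ 1 0 1 σ E
  escape-exposed {E} none σ = record
    { labelings = σ ∷ []
    ; covers    = λ {ω} agrees _ → here (All.map (≈-from {ω} agrees) none)
    ; bound     = ≤-reflexive (trans (cong suc (*-zeroʳ (completions E))) (sym (trans (*-identityʳ _) (product≡1 none))))
    }
    where
    product≡1 : ∀ {vs} → All (λ v → frees E v ≡ []) vs → product (map (λ v → free E v !) vs) ≡ 1
    product≡1 []           = refl
    product≡1 (eq ∷ none) rewrite eq = trans (+-identityʳ _) (product≡1 none)
    ≈-from : ∀ {ω v} → Agrees ω σ E → frees E v ≡ [] → ω v ≈ₚ σ v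
    ≈-from {ω} {v} agrees eq i with (v , σ v ⟨$⟩ʳ i) ∈ₛ? E
    ... | no i∉  = contradiction (subst (_ ∈_) eq (∈-frees⁺ i∉)) λ ()
    ... | yes i∈ = trans (cong (ω v ⟨$⟩ʳ_) (trans (sym (inverseˡ (σ v))) (sym (,-injective (agrees i∈))))) (inverseʳ (ω v))

  -- Even the trivial bound 1 calls for a list of all completions on `S`. It arises by revealing the
  -- open slots over `S` one by one, in any order.
  escape-trivial : ∀ σ E → Escape≤ 1 0 1 σ E
  escape-trivial σ E = go (sum (map (free E) S)) σ E ≤-refl
    where
    go : ∀ n σ E → sum (map (free E) S) ≤ n → Escape≤ 1 0 1 σ E
    go n σ E ≤n with All.all? (λ v → free E v ≟ 0) S
    ... | yes none = escape-exposed (All.map length≡0⇒[] none) σ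
      where
      length≡0⇒[] : ∀ {A : Set} {xs : List A} → length xs ≡ 0 → xs ≡ []
      length≡0⇒[] {xs = []} _ = refl
    ... | no ¬none with find (All.¬All⇒Any¬ (λ v → free E v ≟ 0) S ¬none)
    ...   | v , v∈S , free≢0 with frees E v in eq
    ...     | []    = contradiction refl free≢0
    ...     | p ∷ _ = escape-uniform v∈S p∉ λ q q∉ → descend n ≤n (swapAt σ v p q)
      where
      p∉ : (v , p) ∉ E
      p∉ = ∈-frees⁻ (subst (p ∈_) (sym eq) (here refl))
      sum-∷ : sum (map (free E) S) ≡ suc (sum (map (free ((v , p) ∷ E)) S))
      sum-∷ with sum-update {f = free E} {g = free ((v , p) ∷ E)}
                   (λ w≢v → cong length (sym (frees-∷-≢ (w≢v ∘ sym)))) v∈S S!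
      ... | r , f≡ , g≡ = trans f≡ (trans (cong (_+ r) (free-∷ p∉)) (cong suc (sym g≡)))
      descend : ∀ n → sum (map (free E) S) ≤ n → ∀ σ′ → Escape≤ 1 0 1 σ′ ((v , p) ∷ E)
      descend n ≤n σ′ with n | subst (_≤ n) sum-∷ ≤n
      ... | suc n′ | s≤s ≤n′ = go n′ σ′ ((v , p) ∷ E) ≤n′

  -- Ties a state to the walk: all labelings compatible with the revealed labels share the history
  -- up to `time`, and `vs` contains every vertex visited in it.
  record Trail (h : State) (vs : List Vertex) : Set where
    field
      tails   : ∀ {s} → s ∈ exposed h → proj₁ s ∈ vs
      heads   : ∀ {s} → s ∈ exposed h → head (arcOf (lab h) s) ∈ vs
      current : proj₁ (cur h) ∈ vs
      unique  : Unique vs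
      time    : ℕ
      now     : ∀ {ω} → Agrees ω (lab h) (exposed h) → walk ω v₀ ℓ time ≡ arcOf ω (cur h)
      past    : ∀ {ω} → Agrees ω (lab h) (exposed h) → ∀ {s} → s ∈ exposed h →
        ∃[ t ] t < time × walk ω v₀ ℓ t ≡ arcOf ω s

  open Trail

  -- The walk has left through every revealed slot before, so it now repeats an arc.
  trail-cycles : ∀ {h vs} → Trail h vs → cur h ∈ exposed h → ∀ {ω} → Agrees ω (lab h) (exposed h) → Cycles v₀ ℓ ω
  trail-cycles T c∈ agrees with past T agrees c∈
  ... | t , t< , eq = t , time T , t< , trans eq (sym (now T agrees))

  trail-expose : ∀ {h vs ws q} → Trail h vs → cur h ∉ exposed h → (proj₁ (cur h) , q) ∉ exposed h →
    (∀ {v} → v ∈ vs → v ∈ ws) → proj₁ (cur (expose h q)) ∈ ws → Unique ws → Trail (expose h q) ws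
  trail-expose {state σ E (v , p)} {q = q} T p∉ q∉ vs⊆ws new∈ ws! = λ where
      .tails (here refl)  → vs⊆ws (current T)
      .tails (there s∈)   → vs⊆ws (tails T s∈)
      .heads (here refl)  → subst (_∈ _) (cong head (sym (arcOf-swapAt-≡ σ))) new∈
      .heads (there s∈)   → subst (_∈ _) (cong head (sym (arcOf-swapAt-∈ σ p∉ q∉ s∈))) (vs⊆ws (heads T s∈))
      .current            → new∈
      .unique             → ws!
      .time               → suc (time T)
      .now                → now′
      .past {ω} agrees (here refl) → time T , ≤-refl , now T (old {ω} agrees)
      .past {ω} agrees (there s∈)  → let t , t< , eq = past T (old {ω} agrees) s∈ in t , m<n⇒m<1+n t< , eq
    where
    old : ∀ {ω} → Agrees ω (swapAt σ v p q) ((v , p) ∷ E) → Agrees ω σ E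
    old {ω} = agrees-swapAt⁻ {ω} p∉ q∉
    now′ : ∀ {ω} → Agrees ω (swapAt σ v p q) ((v , p) ∷ E) →
      walk ω v₀ ℓ (suc (time T)) ≡ arcOf ω (enter (v , σ v ⟨$⟩ˡ q) (suc (toℕ p)))
    now′ {ω} agrees =
      trans (cong (step ω) (now T (old {ω} agrees)))
      -- The arc just traversed carries the port `p` it was left through; next, its index is read
      -- off from the newly revealed label.
      (trans (cong (λ n → arcOf ω (enter (v , ω v ⟨$⟩ˡ p) (suc (toℕ n)))) (inverseʳ (ω v)))
             (cong (λ a → arcOf ω (enter a (suc (toℕ p)))) (trans (agrees (here refl)) (arcOf-swapAt-≡ σ))))

  -- Recursive along arcs, so that one number serves both as the remaining radius and as the number
  -- of steps left.
  BallWithin : ℕ → Vertex → Set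
  BallWithin zero    v = v ∈ S
  BallWithin (suc n) v = v ∈ S × ∀ k → BallWithin n (nbr v k)

  -- Geometric decay of the escape probability.

  module Bounded (D : ℕ) .{{_ : NonZero D}} (deg≤D : ∀ v → deg v ≤ D) where

    open Rates D

    -- A step to an old vertex uses up weight deg v !, and so does a step to a
    -- new vertex of smaller degree, whose arcs weigh less than that in total.
    trail-step : ∀ {h vs q} → Trail h vs → cur h ∉ exposed h → (proj₁ (cur h) , q) ∉ exposed h →
      ∃[ ws ] Trail (expose h q) ws ×
        potential (exposed (expose h q)) ws ≤ potential (exposed h) vs + W ×
        (potential (exposed (expose h q)) ws < potential (exposed h) vs ⊎ Closable (expose h q) L)
    trail-step {state σ E (v , p)} {vs} {q} T p∉ q∉ with nbr v (σ v ⟨$⟩ˡ q) ∈ᵥ? vs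
    ... | yes u∈ = vs , trail-expose T p∉ q∉ id u∈ (unique T) ,
          ≤-trans (<⇒≤ drop) (m≤m+n _ W) , inj₁ drop
      where
      drop : potential ((v , p) ∷ E) vs < potential E vs
      drop = subst (potential ((v , p) ∷ E) vs <_) (sym (potential-∷ (current T) (unique T) p∉))
               (m<n+m _ (1≤n! (deg v)))
    ... | no u∉ = u ∷ vs ,
          trail-expose T p∉ q∉ there (here refl) (All.tabulate (λ w∈ u≡w → u∉ (subst (_∈ vs) (sym u≡w) w∈)) ∷ unique T) ,
          (begin
            free E′ u * deg u ! + potential E′ vs  ≤⟨ +-monoˡ-≤ _ (*-monoˡ-≤ (deg u !) (free≤deg {E′})) ⟩
            deg u * deg u ! + potential E′ vs      ≤⟨ +-mono-≤ (*-mono-≤ (deg≤D u) (!-mono-≤ (deg≤D u))) (≤-trans (m≤n+m _ _) (≤-reflexive (sym pot))) ⟩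
            W + potential E vs                     ≡⟨ +-comm W _ ⟩
            potential E vs + W                     ∎) ,
          progress
      where
      open ≤-Reasoning
      E′ = (v , p) ∷ E
      u = nbr v (σ v ⟨$⟩ˡ q)
      pot = potential-∷ (current T) (unique T) p∉
      v≢u : v ≢ u
      v≢u v≡u = ~-irrefl (subst (_~ u) v≡u (nbr-sound v _))
      progress : free E′ u * deg u ! + potential E′ vs < potential E vs ⊎ Closable (expose (state σ E (v , p)) q) L
      progress with deg u <? deg v
      ... | yes du<dv = inj₁ (begin-strict
            free E′ u * deg u ! + potential E′ vs  ≤⟨ +-monoˡ-≤ _ (*-monoˡ-≤ (deg u !) (free≤deg {E′})) ⟩
            deg u * deg u ! + potential E′ vs      <⟨ +-monoˡ-< _ (n*n!<m! du<dv) ⟩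
            deg v ! + potential E′ vs              ≡⟨ pot ⟨
            potential E vs                         ∎)
      ... | no du≮dv with nbr-complete (~-sym (nbr-sound v (σ v ⟨$⟩ˡ q))) | suc-mod-surjective (≮⇒≥ du≮dv) p
      ...   | k , nbr-k | e , e→p = inj₂ (Star.closable k nbr-k p e e→p D _ refl inv (≤-trans (free≤deg {E′}) (deg≤D u)))
        where
        inv : Star.Invariant k nbr-k p e e→p (swapAt σ v p q) E′
        -- Since `u` is new, no slot at `u` is revealed, and the arc just taken is the only revealed
        -- one into `u`.
        inv = record
          { origin  = here refl
          ; e-open  = λ { (here eq) → v≢u (sym (cong proj₁ eq)) ; (there e∈) → u∉ (tails T e∈) }
          ; p-open  = λ { (here eq) → contradiction (sym (cong proj₁ eq)) v≢u ; (there r∈) → contradiction (tails T r∈) u∉ }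
          ; balance = λ { (here refl) _ q≢v → contradiction refl q≢v
                        ; (there r∈) head≡u _ → contradiction
                            (subst (_∈ vs) (trans (cong head (sym (arcOf-swapAt-∈ σ p∉ q∉ r∈))) head≡u) (heads T r∈)) u∉ }
          }

    mutual

      -- The bound is `(C / B) ^ k`, for `k` attempts still to come. A step either lowers the
      -- potential or begins an attempt, whose whole cost is covered by one `Z`; hence `n` never
      -- runs out early.
      escape : ∀ k n {h vs} → Trail h vs → BallWithin n (proj₁ (cur h)) →
        potential (exposed h) vs + k * Z ≤ n → Escape≤ (B ^ k) 0 (C ^ k) (lab h) (exposed h)
      escape zero n T _ _ = escape-trivial _ _
      escape (suc k) zero {h} {vs} T _ fuel = contradiction (≤-trans (m≤n+m (suc k * Z) (potential (exposed h) vs)) fuel) λ ()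
      escape (suc k) (suc n) {h} {vs} T (v∈S , within) fuel with cur h ∈ₛ? exposed h
      ... | yes c∈ = escape-cycling (trail-cycles T c∈) z≤n
      ... | no c∉  = escape-uniform v∈S c∉ child
        where
        child : ∀ q → (proj₁ (cur h) , q) ∉ exposed h →
          Escape≤ (B ^ suc k) 0 (C ^ suc k) (lab (expose h q)) (exposed (expose h q))
        child q q∉ with trail-step T c∉ q∉
        ... | ws , T′ , _ , inj₁ drop = escape (suc k) n T′ (within _) (s≤s⁻¹ (≤-trans (+-monoˡ-≤ (suc k * Z) drop) fuel))
        ... | ws , T′ , rise , inj₂ closable =
              -- One `Z` splits into `suc W` for the present step with its rise in potential and
              -- `suc W` for each of the `L` steps of the attempt.
              settle (escape-closable k n 0 L T′ (within _) closable refl (s≤s⁻¹ (begin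
                suc (P′ + k * Z + L * suc W)         ≤⟨ s≤s (+-monoˡ-≤ (L * suc W) (+-monoˡ-≤ (k * Z) rise)) ⟩
                suc (P + W + k * Z + L * suc W)      ≡⟨ rearrange P W (k * Z) (L * suc W) ⟩
                P + (suc W + L * suc W + k * Z)      ≤⟨ fuel ⟩
                suc n                                ∎)))
          where
          open ≤-Reasoning
          P = potential (exposed h) vs
          P′ = potential (exposed (expose h q)) ws
          rearrange : ∀ p w z l → suc (p + w + z + l) ≡ p + (suc w + l + z)
          rearrange = solve-∀
          -- From `B` equal to `C + 1`: `C ^ k * B - C ^ k` is `C ^ suc k`.
          settle : ∀ {σ E} → Escape≤ (B ^ suc k) (C ^ k * 1) (C ^ k * B) σ E → Escape≤ (B ^ suc k) 0 (C ^ suc k) σ E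
          settle {E = E} c = record { labelings = labelings c ; covers = covers c ; bound = +-cancelʳ-≤ (N * (C ^ k * 1)) _ _ (begin
              m + N * 0 + N * (C ^ k * 1)          ≡⟨ cong (_+ N * (C ^ k * 1)) (trans (cong (m +_) (*-zeroʳ N)) (+-identityʳ m)) ⟩
              m + N * (C ^ k * 1)                  ≤⟨ bound c ⟩
              N * (C ^ k * B)                      ≡⟨ cong (λ b → N * (C ^ k * b)) B≡1+C ⟩
              N * (C ^ k * suc C)                  ≡⟨ expand N (C ^ k) C ⟩
              N * (C * C ^ k) + N * (C ^ k * 1)    ∎) }
            where
            N = completions E
            m = length (labelings c) * B ^ suc k
            expand : ∀ n x c → n * (x * suc c) ≡ n * (c * x) + n * (x * 1)
            expand = solve-∀

      -- In the middle of an attempt, with `i` steps made and `j` left, the bound is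
      -- `(C / B) ^ k * (1 - 1 / D ^ j)`, because `D ^ i / B` equals `1 / D ^ j`. Each favourable
      -- choice has probability at least `1 / D`.
      escape-closable : ∀ k n i j {h vs} → Trail h vs → BallWithin n (proj₁ (cur h)) → Closable h j → i + j ≡ L →
        potential (exposed h) vs + k * Z + j * suc W ≤ n →
        Escape≤ (B ^ suc k) (C ^ k * D ^ i) (C ^ k * B) (lab h) (exposed h)
      escape-closable k n i j T _ (closed c∈) i+j≡L _ =
        escape-cycling (trail-cycles T c∈) (*-monoʳ-≤ (C ^ k) (^-monoʳ-≤ D (≤-trans (m≤m+n i j) (≤-reflexive i+j≡L))))
      escape-closable k zero i (suc j) {h} {vs} T _ (choose _ _ _ _) _ fuel =
        contradiction (≤-trans (m≤n+m (suc j * suc W) (potential (exposed h) vs + k * Z)) fuel) λ ()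
      escape-closable k (suc n) i (suc j) {h} {vs} T (v∈S , within) (choose c∉ g g∉ closable) i+j≡L fuel =
        escape-average x child v∈S c∉ (begin
          free (exposed h) v * (C ^ k * D ^ i)   ≤⟨ *-monoˡ-≤ (C ^ k * D ^ i) (≤-trans (free≤deg {exposed h}) (deg≤D v)) ⟩
          D * (C ^ k * D ^ i)                    ≡⟨ rearrange D (C ^ k) (D ^ i) ⟩
          C ^ k * (D * D ^ i)                    ≡⟨ x-g ⟨
          x g                                    ≤⟨ ≤-sum x (∈-frees⁺ g∉) ⟩
          sum (map x (frees (exposed h) v))      ∎)
        where
        open ≤-Reasoning
        v = proj₁ (cur h)
        x : Port v → ℕ
        -- Only the favourable port `g` earns credit; the factor `D` it gains makes up for averaging
        -- over at most `D` open ports.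
        x q with q Fin.≟ g
        ... | yes _ = C ^ k * D ^ suc i
        ... | no _  = 0
        x-g : x g ≡ C ^ k * D ^ suc i
        x-g with g Fin.≟ g
        ... | yes _   = refl
        ... | no g≢g = contradiction refl g≢g
        rearrange : ∀ d c e → d * (c * e) ≡ c * (d * e)
        rearrange = solve-∀
        fuel′ : ∀ {P′} → P′ ≤ potential (exposed h) vs + W → P′ + k * Z + j * suc W ≤ n
        fuel′ {P′} rise = s≤s⁻¹ (begin
          suc (P′ + k * Z + j * suc W)       ≤⟨ s≤s (+-monoˡ-≤ (j * suc W) (+-monoˡ-≤ (k * Z) rise)) ⟩
          suc (P + W + k * Z + j * suc W)    ≡⟨ rearrange′ P W (k * Z) (j * suc W) ⟩
          P + k * Z + (suc W + j * suc W)    ≤⟨ fuel ⟩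
          suc n                              ∎)
          where
          P = potential (exposed h) vs
          rearrange′ : ∀ p w z l → suc (p + w + z + l) ≡ p + z + (suc w + l)
          rearrange′ = solve-∀
        child : ∀ q → (v , q) ∉ exposed h →
          Escape≤ (B ^ suc k) (x q) (C ^ k * B) (lab (expose h q)) (exposed (expose h q))
        child q q∉ with q Fin.≟ g | trail-step T c∉ q∉
        ... | yes refl | ws , T′ , rise , _ =
              escape-closable k n (suc i) j T′ (within _) closable (trans (sym (+-suc i j)) i+j≡L) (fuel′ rise)
        -- The attempt has failed, and the `k` later ones remain; their bound is brought to the
        -- denominator `B ^ suc k`.
        ... | no _     | ws , T′ , rise , _ = scale (escape k n T′ (within _) (≤-trans (m≤m+n _ (j * suc W)) (fuel′ rise)))
          where
          scale : ∀ {σ E} → Escape≤ (B ^ k) 0 (C ^ k) σ E → Escape≤ (B ^ suc k) 0 (C ^ k * B) σ E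
          scale {E = E} c = record { labelings = labelings c ; covers = covers c ; bound = begin
              m * (B * B ^ k) + N * 0       ≡⟨ factor m B (B ^ k) N ⟩
              (m * B ^ k + N * 0) * B       ≤⟨ *-monoˡ-≤ B (bound c) ⟩
              N * C ^ k * B                 ≡⟨ *-assoc N _ B ⟩
              N * (C ^ k * B)               ∎ }
            where
            N = completions E
            m = length (labelings c)
            factor : ∀ m b c n → m * (b * c) + n * 0 ≡ (m * c + n * 0) * b
            factor = solve-∀

-- Rational arithmetic.

/-+-1/ : ∀ m d .{{_ : NonZero d}} → (ℤ.+ m /ℚ d) +ℚ (ℤ.+ 1 /ℚ d) ≡ ℤ.+ suc m /ℚ d
/-+-1/ m d@(suc e) = ℚ.toℚᵘ-injective (begin
  toℚᵘ (p +ℚ q)                      ≈⟨ ℚ.toℚᵘ-homo-+ p q ⟩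
  toℚᵘ p ℚᵘ.+ toℚᵘ q                 ≈⟨ ℚᵘ.+-cong (ℚ.toℚᵘ-fromℚᵘ (mkℚᵘ (ℤ.+ m) e)) (ℚ.toℚᵘ-fromℚᵘ (mkℚᵘ (ℤ.+ 1) e)) ⟩
  mkℚᵘ (ℤ.+ m) e ℚᵘ.+ mkℚᵘ (ℤ.+ 1) e ≈⟨ *≡* numerators ⟩
  mkℚᵘ (ℤ.+ suc m) e                 ≈⟨ ℚ.toℚᵘ-fromℚᵘ (mkℚᵘ (ℤ.+ suc m) e) ⟨
  toℚᵘ (ℤ.+ suc m /ℚ d)              ∎)
  where
  open import Relation.Binary.Reasoning.Setoid ℚᵘ.≃-setoid
  p = ℤ.+ m /ℚ d
  q = ℤ.+ 1 /ℚ d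
  rearrange : ∀ x y → (x ℤ.* y ℤ.+ ℤ.1ℤ ℤ.* y) ℤ.* y ≡ (ℤ.1ℤ ℤ.+ x) ℤ.* (y ℤ.* y)
  rearrange = ℤ-Solver.solve-∀
  numerators : (ℤ.+ m ℤ.* ℤ.+ d ℤ.+ ℤ.+ 1 ℤ.* ℤ.+ d) ℤ.* ℤ.+ d ≡ ℤ.+ suc m ℤ.* ℤ.+ (d * d)
  numerators = rearrange (ℤ.+ m) (ℤ.+ d)

1/-*-1/ : ∀ a b .{{_ : NonZero a}} .{{_ : NonZero b}} .{{_ : NonZero (a * b)}} →
  (ℤ.+ 1 /ℚ a) *ℚ (ℤ.+ 1 /ℚ b) ≡ ℤ.+ 1 /ℚ (a * b)
1/-*-1/ a@(suc a′) b@(suc b′) = ℚ.toℚᵘ-injective (begin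
  toℚᵘ (p *ℚ q)                      ≈⟨ ℚ.toℚᵘ-homo-* p q ⟩
  toℚᵘ p ℚᵘ.* toℚᵘ q                 ≈⟨ ℚᵘ.*-cong (ℚ.toℚᵘ-fromℚᵘ (mkℚᵘ (ℤ.+ 1) a′)) (ℚ.toℚᵘ-fromℚᵘ (mkℚᵘ (ℤ.+ 1) b′)) ⟩
  mkℚᵘ (ℤ.+ 1) (pred (a * b))        ≈⟨ ℚ.toℚᵘ-fromℚᵘ (mkℚᵘ (ℤ.+ 1) (pred (a * b))) ⟨
  toℚᵘ (ℤ.+ 1 /ℚ (a * b))            ∎)
  where
  open import Relation.Binary.Reasoning.Setoid ℚᵘ.≃-setoid
  p = ℤ.+ 1 /ℚ a
  q = ℤ.+ 1 /ℚ b

-- A positive rational is at least the reciprocal of its denominator.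
/-≤-positive : ∀ m d .{{_ : NonZero d}} {ε} → 0ℚ <ℚ ε → m * ↧ₙ ε ≤ d → (ℤ.+ m /ℚ d) ≤ℚ ε
/-≤-positive m d@(suc e) {mkℚ (ℤ.+ zero) _ _} (*<* (ℤ.+<+ ())) _
/-≤-positive m d@(suc e) {ε@(mkℚ (ℤ.+ suc n) b _)} _ mb≤d =
  ℚ.toℚᵘ-cancel-≤ (ℚᵘ.≤-respˡ-≃ (ℚᵘ.≃-sym (ℚ.toℚᵘ-fromℚᵘ (mkℚᵘ (ℤ.+ m) e))) (*≤* numerators))
  where
  numerators : ℤ.+ m ℤ.* ℤ.+ suc b ℤ.≤ ℤ.+ suc n ℤ.* ℤ.+ d
  numerators = subst (ℤ._≤ _) (ℤ.pos-* m (suc b)) (ℤ.+≤+ (≤-trans mb≤d (m≤m+n d (n * d))))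

-- Covers by cylinders over `S`.

module Cylinders {G : Graph} (F : LocallyFinite G) (S : List (Graph.Vertex G)) (S! : Unique S) where
  open Graph G
  open LocallyFinite F
  open RandomBasicWalk F

  labelingCount : List Vertex → ℕ
  labelingCount vs = product (map (λ v → deg v !) vs)

  labelingCount≢0 : ∀ vs → NonZero (labelingCount vs)
  labelingCount≢0 []       = _
  labelingCount≢0 (v ∷ vs) = m*n≢0 (deg v !) _ {{deg v !≢0}} {{labelingCount≢0 vs}}

  restrict : Labeling → (vs : List Vertex) → Unique vs → Cylinder
  restrict τ vs vs! = record
    { prescribed = map (λ v → v , τ v) vs
    ; distinct   = subst Unique (trans (sym (map-id vs)) (map-∘ vs)) vs!
    }

  -- Stated for any cylinder with these prescriptions, so that the induction may pass to the tail
  -- with whatever proof of distinctness it has.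
  prob-prescribed : ∀ (τ : Labeling) vs (C : Cylinder) → Cylinder.prescribed C ≡ map (λ v → v , τ v) vs →
    prob C ≡ _/ℚ_ (ℤ.+ 1) (labelingCount vs) {{labelingCount≢0 vs}}
  prob-prescribed τ [] record { prescribed = _ } refl = refl
  prob-prescribed τ (v ∷ vs) record { prescribed = _ ; distinct = _ ∷ u } refl =
    trans (cong (_/ℚ_ (ℤ.+ 1) (deg v !) {{deg v !≢0}} *ℚ_) (prob-prescribed τ vs (record { distinct = u }) refl))
      (1/-*-1/ (deg v !) (labelingCount vs) {{deg v !≢0}} {{labelingCount≢0 vs}} {{labelingCount≢0 (v ∷ vs)}})

  private
    instance
      labelingCountS≢0 : NonZero (labelingCount S)
      labelingCountS≢0 = labelingCount≢0 S

  cover : List Labeling → Cover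
  cover []       _       = nothing
  cover (τ ∷ _)  zero    = just (restrict τ S S!)
  cover (_ ∷ τs) (suc n) = cover τs n

  cover-covers : ∀ τs {ω} → Any (λ τ → All (λ v → ω v ≈ₚ τ v) S) τs →
    ∃[ n ] ∃[ C ] cover τs n ≡ just C × ω ∈ᶜ C
  cover-covers (τ ∷ _)  (here ω≈τ) = 0 , restrict τ S S! , refl , All.map⁺ ω≈τ
  cover-covers (_ ∷ τs) {ω} (there any) with cover-covers τs {ω} any
  ... | n , rest = suc n , rest

  -- `n ⊓ length τs` counts the cylinders among the first `n` entries; the cases are an index inside
  -- the list and one past its end.
  prob-cover : ∀ τs n →
    (prob? (cover τs n) ≡ ℤ.+ 1 /ℚ labelingCount S × suc n ⊓ length τs ≡ suc (n ⊓ length τs)) ⊎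
    (prob? (cover τs n) ≡ 0ℚ × suc n ⊓ length τs ≡ n ⊓ length τs)
  prob-cover []       n       = inj₂ (refl , sym (⊓-zeroʳ n))
  prob-cover (τ ∷ _)  zero    = inj₁ (prob-prescribed τ S (restrict τ S S!) refl , refl)
  prob-cover (_ ∷ τs) (suc n) with prob-cover τs n
  ... | inj₁ (eq , eq′) = inj₁ (eq , cong suc eq′)
  ... | inj₂ (eq , eq′) = inj₂ (eq , cong suc eq′)

  partialSum-cover : ∀ τs n → partialSum (cover τs) n ≡ ℤ.+ (n ⊓ length τs) /ℚ labelingCount S
  partialSum-cover τs zero    = sym (ℚ.0/n≡0 (labelingCount S))
  partialSum-cover τs (suc n) with prob-cover τs n
  ... | inj₁ (eq , eq′) rewrite eq′ = trans (cong₂ _+ℚ_ (partialSum-cover τs n) eq) (/-+-1/ (n ⊓ length τs) (labelingCount S))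
  ... | inj₂ (eq , eq′) rewrite eq′ = trans (cong₂ _+ℚ_ (partialSum-cover τs n) eq) (ℚ.+-identityʳ _)

-- Balls, and the choice of parameters for a given `ε`.

module _ {G : Graph} (F : LocallyFinite G) where
  open Graph G
  open LocallyFinite F

  ball : ℕ → Vertex → List Vertex
  ball zero    v = v ∷ []
  ball (suc n) v = v ∷ concatMap (λ k → ball n (nbr v k)) (allFin (deg v))

theorem4p7 : (G : Graph) (F : LocallyFinite G) (D : ℕ) →
    let open RandomBasicWalk F in
    Infinite G → Connected G → Countable G → DegreeAtMost D →
    (v₀ : Graph.Vertex G) (ℓ : Port v₀) → WithProbabilityOne (Cycles v₀ ℓ)
theorem4p7 G F D₀ _ _ countable deg≤D₀ v₀ ℓ ε ε>0 =
  cover τs , (λ ω ¬cycles → cover-covers τs {ω} (covers c (λ ()) ¬cycles)) , λ n →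
    subst (_≤ℚ ε) (sym (partialSum-cover τs n))
      (/-≤-positive (n ⊓ length τs) M {{labelingCount≢0 S}} ε>0 (≤-trans (*-monoˡ-≤ b (m⊓n≤n n _)) few))
  where
  open Graph G
  open LocallyFinite F
  open RandomBasicWalk F
  -- Raised by one to be nonzero, which makes `B` positive.
  D = suc D₀
  deg≤D : ∀ v → deg v ≤ D
  deg≤D v = m≤n⇒m≤1+n (deg≤D₀ v)
  open Rates D
  _≟ᵥ_ : DecidableEquality Vertex
  _≟ᵥ_ = via-injection countable _≟_
  b = ↧ₙ ε
  -- Enough attempts for `(C / B) ^ k` to be at most `1 / b`, hence at most `ε`.
  k = proj₁ (geometric-decay C b)
  -- `W` bounds the initial potential, so this many steps suffice for `k` attempts.
  radius = W + k * Z
  S = deduplicate _≟ᵥ_ (ball F radius v₀)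
  S! : Unique S
  S! = deduplicate-! _≟ᵥ_ (ball F radius v₀)
  open Exposure F _≟ᵥ_
  open Counting F _≟ᵥ_ S S! v₀ ℓ
  open Bounded D deg≤D
  open Cylinders F S S!
  open Escape≤

  within-ball : ∀ n v → (∀ {w} → w ∈ ball F n v → w ∈ S) → BallWithin n v
  within-ball zero    v ⊆S = ⊆S (here refl)
  within-ball (suc n) v ⊆S = ⊆S (here refl) , λ k → within-ball n (nbr v k)
    λ w∈ → ⊆S (there (∈-concatMap⁺ (λ k → ball F n (nbr v k)) (Any.map (λ { refl → w∈ }) (∈-allFin k))))

  start : State
  -- With nothing revealed, the identity is an arbitrary placeholder.
  start = state (λ _ → idₚ) [] (v₀ , ℓ)

  trail : Trail start (v₀ ∷ [])
  trail = record
    { tails = λ () ; heads = λ () ; current = here refl ; unique = [] ∷ []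
    ; time = 0 ; now = λ _ → refl ; past = λ _ () }

  fuel : potential [] (v₀ ∷ []) + k * Z ≤ radius
  fuel = +-monoˡ-≤ (k * Z) (≤-trans (≤-reflexive (+-identityʳ _))
    (*-mono-≤ (≤-trans (free≤deg {[]}) (deg≤D v₀)) (!-mono-≤ (deg≤D v₀))))

  c : Escape≤ (B ^ k) 0 (C ^ k) (λ _ → idₚ) []
  c = escape k radius trail (within-ball radius v₀ (∈-deduplicate⁺ _≟ᵥ_)) fuel

  τs = labelings c
  M = labelingCount S

  completions-[] : completions [] ≡ M
  completions-[] = cong product (map-cong (λ v → cong _! (free-[] v)) S)

  -- The listed labelings form a fraction of at most `(C / B) ^ k` of all those on `S`, and `k` was
  -- chosen to bring this down to `1 / b`.
  few : length τs * b ≤ M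
  few = *-cancelʳ-≤ _ _ (B ^ k) {{m^n≢0 B k {{m^n≢0 D L}}}} (begin
    length τs * b * B ^ k                          ≡⟨ swap-factors (length τs) b (B ^ k) ⟩
    length τs * B ^ k * b                          ≤⟨ *-monoˡ-≤ b (≤-trans (m≤m+n (length τs * B ^ k) _) (bound c)) ⟩
    completions [] * C ^ k * b                     ≡⟨ *-assoc (completions []) _ b ⟩
    completions [] * (C ^ k * b)                   ≤⟨ *-monoʳ-≤ (completions []) (proj₂ (geometric-decay C b)) ⟩
    completions [] * suc C ^ k                     ≡⟨ cong₂ (λ n m → n * m ^ k) completions-[] (sym B≡1+C) ⟩
    M * B ^ k                                      ∎)
    where
    open ≤-Reasoning
    swap-factors : ∀ x y z → x * y * z ≡ x * z * y
    swap-factors = solve-∀
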